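{- Let $m\in\mathbb N$. Suppose that $G$ is a digraph on $n:=3m$ vertices such that for every $x\in V(G)$, $d^+(x)\ge 2n/3$ or $d^-(x)\ge 2n/3$. Then $G$ contains a perfect $T_3$-packing.
   Context: A digraph has no loops and at most one edge in each direction between any two vertices; $d^+(x)$ and $d^-(x)$ denote the out- and indegree of $x$. $T_3$ denotes the transitive tournament on $3$ vertices. A $T_3$-packing is a collection of vertex-disjoint copies of $T_3$ in $G$ (not necessarily induced); it is perfect if it covers all vertices of $G$. -}

module Defs where

open import Data.Nat using (ℕ; _*_; _≥_)
open import Data.Fin using (Fin; zero; suc)
open import Data.Fin.Properties using (any?)
open import Data.Product using (Σ; _×_; _,_; ∃)
open import Data.List using (List; length; filter; allFin)
open import Relation.Nullary using (¬_; Dec)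
open import Relation.Binary.PropositionalEquality using (_≡_)
open import Relation.Unary using (Decidable)

-- A digraph on vertex set Fin n: a decidable irreflexive edge relation.
-- "At most one edge in each direction" is automatic for a relation;
-- antiparallel edges x→y and y→x are allowed.
record Digraph (n : ℕ) : Set₁ where
  field
    Edge      : Fin n → Fin n → Set
    edge?     : (x y : Fin n) → Dec (Edge x y)
    loopless  : (x : Fin n) → ¬ Edge x x
open Digraph public

outdeg : {n : ℕ} → Digraph n → Fin n → ℕ
outdeg {n} G x = length (filter (λ y → edge? G x y) (allFin n))

indeg : {n : ℕ} → Digraph n → Fin n → ℕ
indeg {n} G x = length (filter (λ y → edge? G y x) (allFin n))

IsT3 : {n : ℕ} → Digraph n → Fin n → Fin n → Fin n → Set
IsT3 G a b c = Edge G a b × Edge G a c × Edge G b c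

PerfectT3Packing : (m : ℕ) → Digraph (3 * m) → Set
PerfectT3Packing m G =
  Σ (Fin m → Fin 3 → Fin (3 * m)) λ P →
    ((i : Fin m) → IsT3 G (P i zero) (P i (suc zero)) (P i (suc (suc zero))))
  × (∀ i j i' j' → P i j ≡ P i' j' → (i ≡ i') × (j ≡ j'))
  × ((v : Fin (3 * m)) → ∃ λ i → ∃ λ j → P i j ≡ v)

{-# OPTIONS --safe #-}

-- Orient each vertex x by its large side: let x ⟶ y mean that y is an outneighbour of x if
-- d⁺(x) ≥ 2m, and an inneighbour otherwise.  In the new digraph all outdegrees are at least
-- 2m, and a triangle in which one vertex sends edges to the other two is a T₃ of G.
--
-- Add all missing edges, so that a packing exists, and then delete the added edges one at a
-- time.  A deletion breaks at most one triangle, so one has to turn m − 1 triangles and a leftover path xyz into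
-- a packing.  By counting, some triangle abc receives at least 7 edges from {x, y, z}.  Then either
-- the six vertices split into two triangles, or, up to exchanges, I = {x, z, a} is independent,
-- J = {y, b, c}, I and J are completely linked and every {i, j, j′} is a triangle.
--
-- Counting again, some triangle K receives at least 7 edges from I; then J sends no edge to K, and
-- for each j ∈ J at most 4 edges enter j from I ∪ K, or else I ∪ J ∪ K splits into triangles.
-- Summing the outdegrees over I ∪ J ∪ K, some further triangle T receives at least 19 edges from
-- I ∪ J ∪ K, at most 6 of them from I, and in that case I ∪ J ∪ K ∪ T splits into four triangles.
module Submission where

open import Defs
open import Data.Nat using (ℕ; _*_; _≥_)
open import Data.Fin using (Fin)
open import Data.Sum using (_⊎_)

open import Data.Nat using (zero; suc; _+_; _≤_; _<_; _≤?_; z≤n; s≤s)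
open import Data.Nat.Properties
open import Data.Nat.ListAction using (sum)
open import Data.Nat.ListAction.Properties using (sum-↭; sum-++)
open import Data.Nat.Solver using (module +-*-Solver)
open import Data.Fin using (zero; suc; cast)
open import Data.Fin.Properties using (any?; all?; cast-involutive) renaming (_≟_ to _≟ᶠ_)
open import Data.Fin.Subset using (Subset; ∣_∣)
open import Data.Fin.Subset.Properties using (∣p∣≤n)
open import Data.Bool using (Bool; true; false; if_then_else_; _∧_; _∨_)
open import Data.Bool.Properties using (¬-not) renaming (_≟_ to _≟ᵇ_)
open import Data.Vec using (Vec; []; _∷_; lookup; tabulate)
import Data.Vec as Vec
open import Data.Vec.Properties using (lookup∘tabulate; lookup-map)
open import Data.List using (List; []; _∷_; _++_; map; length; concatMap; filter; allFin; cartesianProduct)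
  renaming ([_] to ⟨_⟩)
import Data.List as List
open import Data.List.Properties using (map-++; concatMap-++; length-++; length-tabulate)
open import Data.List.Relation.Unary.All using (All; []; _∷_)
import Data.List.Relation.Unary.All as All
import Data.List.Relation.Unary.All.Properties as All
open import Data.List.Relation.Unary.Any using (here; there)
open import Data.List.Relation.Unary.AllPairs using ([]; _∷_)
open import Data.List.Relation.Unary.Unique.Propositional using (Unique)
open import Data.List.Relation.Unary.Unique.Propositional.Properties using (allFin⁺)
open import Data.List.Membership.Propositional using (_∈_)
open import Data.List.Membership.Propositional.Properties using (∈-allFin; ∈-cartesianProduct⁺; ∈-lookup)
open import Data.List.Relation.Binary.Permutation.Propositional
  using (_↭_; ↭-refl; ↭-sym; ↭-trans; prep; swap; ↭⇒↭ₛ)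
open import Data.List.Relation.Binary.Permutation.Propositional.Properties
  using (map⁺; ++⁺; ++⁺ˡ; ++⁺ʳ; shifts; ↭-length; ∈-resp-↭; ++-commutativeMonoid)
import Data.List.Relation.Binary.Permutation.Setoid.Properties as Permutationₛ
open import Data.Product using (∃; _×_; _,_; proj₁; proj₂)
open import Data.Sum using (inj₁; inj₂; [_,_]′)
import Data.Sum as Sum
open import Function using (_∘_)
open import Relation.Nullary using (¬_; Dec; does; yes; no; contradiction)
open import Relation.Nullary.Decidable
  using (map′; from-yes; dec-true; dec-false; ¬?; _×-dec_; _⊎-dec_; _→-dec_)
open import Relation.Unary using (Decidable)
open import Relation.Binary.PropositionalEquality
  using (_≡_; _≢_; refl; sym; trans; cong; cong₂; subst; setoid)
import Algebra.Solver.CommutativeMonoid as CommutativeMonoidSolver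

-- Bipartite graphs between two triples

pattern 0F = zero
pattern 1F = suc zero
pattern 2F = suc (suc zero)

next : Fin 3 → Fin 3
next 0F = 1F
next 1F = 2F
next 2F = 0F

next² : Fin 3 → Fin 3
next² = next ∘ next

-- Stored as the set of in-neighbours of each target.
Bip : Set
Bip = Vec (Subset 3) 3

infix 4 _∈ₛ_ _∈ₛ?_
_∈ₛ_ : Fin 3 → Subset 3 → Set
i ∈ₛ u = lookup u i ≡ true

_∈ₛ?_ : ∀ i u → Dec (i ∈ₛ u)
i ∈ₛ? u = lookup u i ≟ᵇ true

_[_↦_] : Bip → Fin 3 → Fin 3 → Set
M [ i ↦ t ] = i ∈ₛ lookup M t

edges : Bip → ℕ
edges M = Vec.sum (Vec.map ∣_∣ M)

-- As t, next t, next² t exhaust Fin 3, this says that i is joined to both targets other than t.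
Dominates : Bip → Fin 3 → Fin 3 → Set
Dominates M i t = M [ i ↦ next t ] × M [ i ↦ next² t ]

edges≤9 : ∀ M → edges M ≤ 9
edges≤9 (u ∷ v ∷ w ∷ []) = +-mono-≤ (∣p∣≤n u) (+-mono-≤ (∣p∣≤n v) (+-mono-≤ (∣p∣≤n w) z≤n))

-- Three columns holding at most 3 edges each would account for only 9.
heavy-column : ∀ F G → 10 ≤ edges F + edges G → ∃ λ t → 4 ≤ ∣ lookup F t ∣ + ∣ lookup G t ∣
heavy-column F@(u₀ ∷ u₁ ∷ u₂ ∷ []) G@(v₀ ∷ v₁ ∷ v₂ ∷ []) 10≤
  with any? (λ t → 4 ≤? ∣ lookup F t ∣ + ∣ lookup G t ∣)
... | yes found = found
... | no none = contradiction 10≤ (<⇒≱ (s≤s (≤-trans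
  (≤-reflexive (solve 6 (λ a b c d e f →
     (a :+ (b :+ (c :+ con 0))) :+ (d :+ (e :+ (f :+ con 0))) := (a :+ d) :+ ((b :+ e) :+ (c :+ f))) refl
     (∣ u₀ ∣) (∣ u₁ ∣) (∣ u₂ ∣) (∣ v₀ ∣) (∣ v₁ ∣) (∣ v₂ ∣)))
  (+-mono-≤ (≤3 0F) (+-mono-≤ (≤3 1F) (≤3 2F))))))
  where
  open +-*-Solver
  ≤3 : ∀ t → ∣ lookup F t ∣ + ∣ lookup G t ∣ ≤ 3
  ≤3 t = ≤-pred (≰⇒> λ h → none (t , h))

-- Finite search over subsets and bipartite graphs

hasEdge? : ∀ M i t → Dec (M [ i ↦ t ])
hasEdge? M i t = i ∈ₛ? lookup M t

dominates? : ∀ M i t → Dec (Dominates M i t)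
dominates? M i t = hasEdge? M i (next t) ×-dec hasEdge? M i (next² t)

∀Subset? : ∀ {n} {P : Subset n → Set} → Decidable P → Dec (∀ u → P u)
∀Subset? {zero} P? = map′ (λ { p [] → p }) (λ f → f []) (P? [])
∀Subset? {suc n} P? =
  map′ (λ { (p , q) (true ∷ u) → p u ; (p , q) (false ∷ u) → q u })
       (λ f → f ∘ (true ∷_) , f ∘ (false ∷_))
       (∀Subset? (P? ∘ (true ∷_)) ×-dec ∀Subset? (P? ∘ (false ∷_)))

∀Bip? : {P : Bip → Set} → Decidable P → Dec (∀ M → P M)
∀Bip? P? =
  map′ (λ { f (u ∷ v ∷ w ∷ []) → f u v w }) (λ f u v w → f (u ∷ v ∷ w ∷ []))
       (∀Subset? λ u → ∀Subset? λ v → ∀Subset? λ w → P? (u ∷ v ∷ w ∷ []))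

infix 4 _≢?_
_≢?_ : (i j : Fin 3) → Dec (i ≢ j)
i ≢? j = ¬? (i ≟ᶠ j)

-- Between a leftover triple and a triangle: `w` takes the two targets other than `t`, and the other
-- two sources, if adjacent, form a triangle with `t`.
Exchange : Bip → Fin 3 → Set
Exchange M w = ∃ λ t → M [ next w ↦ t ] × M [ next² w ↦ t ] × Dominates M w t

exchange? : ∀ M → Decidable (Exchange M)
exchange? M w = any? λ t → hasEdge? M (next w) t ×-dec hasEdge? M (next² w) t ×-dec dominates? M w t

-- For `M` from I to K and `H` from K to T: `k` leaves K to join `i′` and `t`, and its two
-- companions form a triangle with `s`. The source `i″` stays free for the third vertex of T.
Detour : Bip → Bip → Fin 3 → Fin 3 → Fin 3 → Set
Detour M H t s i″ = ∃ λ i′ → ∃ λ k →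
  i′ ≢ i″ × M [ i′ ↦ k ] × H [ k ↦ t ] × H [ next k ↦ s ] × H [ next² k ↦ s ]

detour? : ∀ M H t s i″ → Dec (Detour M H t s i″)
detour? M H t s i″ = any? λ i′ → any? λ k → i′ ≢? i″ ×-dec hasEdge? M i′ k ×-dec
  hasEdge? H k t ×-dec hasEdge? H (next k) s ×-dec hasEdge? H (next² k) s

Heavy : ℕ → ℕ → Set
Heavy f g = 2 ≤ f × 1 ≤ g

heavy? : ∀ f g → Dec (Heavy f g)
heavy? f g = 2 ≤? f ×-dec 1 ≤? g

Split : Vec ℕ 3 → Vec ℕ 3 → Fin 3 → Set
Split f g t = 3 ≤ lookup f t × Both (next t) × Both (next² t)
  where
  Both : Fin 3 → Set
  Both s = 1 ≤ lookup f s × 1 ≤ lookup g s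

split? : ∀ f g → Decidable (Split f g)
split? f g t = 3 ≤? lookup f t ×-dec both? (next t) ×-dec both? (next² t)
  where
  both? : ∀ s → Dec (1 ≤ lookup f s × 1 ≤ lookup g s)
  both? s = 1 ≤? lookup f s ×-dec 1 ≤? lookup g s

-- Facts on dense bipartite graphs and column sizes, settled by exhaustion

abstract
  -- Used with `u` and `v` the in-neighbours of one vertex, which then forms a triangle with `i′`
  -- and `k`. The bound 4 is sharp: if `u` has one element and `v` two, the two missing edges may be
  -- those between them.
  crossing : (M : Bip) → 7 ≤ edges M → ∀ u v → 4 ≤ ∣ u ∣ + ∣ v ∣ →
    ∃ λ k → ∃ λ i′ → ∃ λ i →
      k ∈ₛ v × i′ ∈ₛ u × i ≢ i′ × M [ i′ ↦ k ] × Dominates M i k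
  crossing = from-yes (∀Bip? λ M → 7 ≤? edges M →-dec ∀Subset? λ u → ∀Subset? λ v →
    4 ≤? ∣ u ∣ + ∣ v ∣ →-dec any? λ k → any? λ i′ → any? λ i →
      k ∈ₛ? v ×-dec i′ ∈ₛ? u ×-dec i ≢? i′ ×-dec hasEdge? M i′ k ×-dec dominates? M i k)

  -- The case of `crossing` in which `u` is everything and `v` is `t` alone.
  crossing-target : (M : Bip) → 7 ≤ edges M → ∀ t → ∃ λ i′ → ∃ λ i → i ≢ i′ × M [ i′ ↦ t ] × Dominates M i t
  crossing-target = from-yes (∀Bip? λ M → 7 ≤? edges M →-dec all? λ t → any? λ i′ → any? λ i →
    i ≢? i′ ×-dec hasEdge? M i′ t ×-dec dominates? M i t)

  -- Follows the case of `crossing` in which `u` is `i′` alone and `v` is everything.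
  dominator-avoiding : (M : Bip) → 7 ≤ edges M → ∀ i′ → ∃ λ k → ∃ λ i → i ≢ i′ × Dominates M i k
  dominator-avoiding = from-yes (∀Bip? λ M → 7 ≤? edges M →-dec all? λ i′ → any? λ k → any? λ i →
    i ≢? i′ ×-dec dominates? M i k)

  -- Each edge is required by 4 of the 9 choices of `w` and `t`, so two missing edges spoil at most
  -- 8 of them.
  exchangeable : (M : Bip) → 7 ≤ edges M → ∃ (Exchange M)
  exchangeable = from-yes (∀Bip? λ M → 7 ≤? edges M →-dec any? (exchange? M))

  -- In the last alternative both ends of the path may miss the same vertex t.
  exchangeable-at-end : (M : Bip) → 7 ≤ edges M →
    Exchange M 0F ⊎ Exchange M 2F ⊎
    ∃ λ t → (∀ s → M [ 1F ↦ s ]) × Dominates M 0F t × Dominates M 2F t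
  exchangeable-at-end = from-yes (∀Bip? λ M → 7 ≤? edges M →-dec
    (exchange? M 0F ⊎-dec exchange? M 2F ⊎-dec any? λ t →
      all? (hasEdge? M 1F) ×-dec dominates? M 0F t ×-dec dominates? M 2F t))

  third : (i i′ : Fin 3) → i ≢ i′ → ∃ λ i″ → i ≢ i″ × i′ ≢ i″
  third = from-yes (all? λ i → all? λ i′ → i ≢? i′ →-dec any? λ i″ → i ≢? i″ ×-dec i′ ≢? i″)

  second-element : ∀ u → 2 ≤ ∣ u ∣ → ∀ i → ∃ λ i′ → i′ ∈ₛ u × i ≢ i′
  second-element = from-yes (∀Subset? λ u → 2 ≤? ∣ u ∣ →-dec all? λ i → any? λ i′ →
    i′ ∈ₛ? u ×-dec i ≢? i′)

  all-in : ∀ u → 3 ≤ ∣ u ∣ → ∀ i → i ∈ₛ u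
  all-in = from-yes (∀Subset? λ u → 3 ≤? ∣ u ∣ →-dec all? (_∈ₛ? u))

  inhabited : ∀ u → 1 ≤ ∣ u ∣ → ∃ (_∈ₛ u)
  inhabited = from-yes (∀Subset? λ u → 1 ≤? ∣ u ∣ →-dec any? (_∈ₛ? u))

  missing-one : (u : Subset 3) → ∀ i → lookup u i ≡ false → ∣ u ∣ ≤ 2
  missing-one = from-yes (∀Subset? {3} λ u → all? λ i → lookup u i ≟ᵇ false →-dec ∣ u ∣ ≤? 2)

  missing-two : (u : Subset 3) → ∀ i i′ → i ≢ i′ → lookup u i ≡ false → lookup u i′ ≡ false → ∣ u ∣ ≤ 1
  missing-two = from-yes (∀Subset? {3} λ u → all? λ i → all? λ i′ → i ≢? i′ →-dec
    lookup u i ≟ᵇ false →-dec lookup u i′ ≟ᵇ false →-dec ∣ u ∣ ≤? 1)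

  empty : (u : Subset 3) → (∀ i → ¬ i ∈ₛ u) → ∣ u ∣ ≤ 0
  empty = from-yes (∀Subset? {3} λ u → all? (λ i → ¬? (i ∈ₛ? u)) →-dec ∣ u ∣ ≤? 0)

  full : (M : Bip) → 9 ≤ edges M → ∀ i t → M [ i ↦ t ]
  full = from-yes (∀Bip? λ M → 9 ≤? edges M →-dec all? λ i → all? (hasEdge? M i))

  -- `H` misses at most one edge, so one of the two columns `s` is full. Then every `k` with an edge
  -- to `t` qualifies; there are at least two, hence at least four pairs with the two allowed `i′`,
  -- and `M` misses at most two.
  detour : (H : Bip) → 8 ≤ edges H → (M : Bip) → 7 ≤ edges M → ∀ t i₁ i₂ →
    Detour M H t (next t) i₂ ⊎ Detour M H t (next² t) i₁
  detour = from-yes (∀Bip? λ H → 8 ≤? edges H →-dec ∀Bip? λ M → 7 ≤? edges M →-dec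
    all? λ t → all? λ i₁ → all? λ i₂ →
      detour? M H t (next t) i₂ ⊎-dec detour? M H t (next² t) i₁)

  -- A light column has total at most 4, and at most 3 if `g` vanishes there. If `g` vanishes
  -- nowhere, each `f` is at most 1 and `g` sums to at least 8; if it vanishes more than once, the
  -- total is at most 10. So the columns are (3, 0), (1, 3), (1, 3) in some order. Using sizes alone
  -- keeps the search to 4^6 cases.
  unbalanced-sizes : ∀ {f₀} → f₀ < 4 → ∀ {g₀} → g₀ < 4 → ¬ Heavy f₀ g₀ →
    ∀ {f₁} → f₁ < 4 → ∀ {g₁} → g₁ < 4 → ¬ Heavy f₁ g₁ →
    ∀ {f₂} → f₂ < 4 → ∀ {g₂} → g₂ < 4 → ¬ Heavy f₂ g₂ →
    let f = f₀ ∷ f₁ ∷ f₂ ∷ [] ; g = g₀ ∷ g₁ ∷ g₂ ∷ [] in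
    11 ≤ Vec.sum f + Vec.sum g → Vec.sum f ≤ 6 → Vec.sum g ≤ 6 →
    Vec.sum f + Vec.sum g ≤ 11 × ∃ (Split f g)
  unbalanced-sizes =
    from-yes (allUpTo? (λ f₀ → allUpTo? (λ g₀ → ¬? (heavy? f₀ g₀) →-dec
              allUpTo? (λ f₁ → allUpTo? (λ g₁ → ¬? (heavy? f₁ g₁) →-dec
              allUpTo? (λ f₂ → allUpTo? (λ g₂ → ¬? (heavy? f₂ g₂) →-dec
      let f = f₀ ∷ f₁ ∷ f₂ ∷ [] ; g = g₀ ∷ g₁ ∷ g₂ ∷ [] in
      11 ≤? Vec.sum f + Vec.sum g →-dec Vec.sum f ≤? 6 →-dec Vec.sum g ≤? 6 →-dec
        (Vec.sum f + Vec.sum g ≤? 11 ×-dec any? (split? f g))) 4) 4) 4) 4) 4) 4)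

unbalanced : ∀ F G → (∀ t → ¬ Heavy ∣ lookup F t ∣ ∣ lookup G t ∣) →
  11 ≤ edges F + edges G → edges F ≤ 6 → edges G ≤ 6 →
  edges F + edges G ≤ 11 × ∃ (Split (Vec.map ∣_∣ F) (Vec.map ∣_∣ G))
unbalanced (u₀ ∷ u₁ ∷ u₂ ∷ []) (v₀ ∷ v₁ ∷ v₂ ∷ []) light =
  unbalanced-sizes (s≤s (∣p∣≤n u₀)) (s≤s (∣p∣≤n v₀)) (light 0F)
                   (s≤s (∣p∣≤n u₁)) (s≤s (∣p∣≤n v₁)) (light 1F)
                   (s≤s (∣p∣≤n u₂)) (s≤s (∣p∣≤n v₂)) (light 2F)

-- Rearranging a few triangles

module _ {V : Set} where

  Triple : Set
  Triple = Fin 3 → V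

  triple : V → V → V → Triple
  triple x y z 0F = x
  triple x y z 1F = y
  triple x y z 2F = z

  vertices : Triple → List V
  vertices T = T 0F ∷ T 1F ∷ T 2F ∷ []

  flatten : List Triple → List V
  flatten = concatMap vertices

  length-flatten : ∀ ts → length (flatten ts) ≡ 3 * length ts
  length-flatten [] = refl
  length-flatten (T ∷ ts) = trans (cong (3 +_) (length-flatten ts)) (sym (*-suc 3 (length ts)))

  rotate : ∀ (T : Triple) t → vertices T ↭ T t ∷ T (next t) ∷ T (next² t) ∷ []
  rotate T 0F = ↭-refl
  rotate T 1F = ↭-trans (swap _ _ ↭-refl) (prep _ (swap _ _ ↭-refl))
  rotate T 2F = ↭-trans (prep _ (swap _ _ ↭-refl)) (swap _ _ ↭-refl)

  permute : ∀ (T : Triple) {i i′ i″} → i ≢ i′ → i ≢ i″ → i′ ≢ i″ → vertices T ↭ T i ∷ T i′ ∷ T i″ ∷ []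
  permute T {0F} {0F} p q r = contradiction refl p
  permute T {0F} {1F} {0F} p q r = contradiction refl q
  permute T {0F} {1F} {1F} p q r = contradiction refl r
  permute T {0F} {1F} {2F} p q r = rotate T 0F
  permute T {0F} {2F} {0F} p q r = contradiction refl q
  permute T {0F} {2F} {1F} p q r = prep _ (swap _ _ ↭-refl)
  permute T {0F} {2F} {2F} p q r = contradiction refl r
  permute T {1F} {0F} {0F} p q r = contradiction refl r
  permute T {1F} {0F} {1F} p q r = contradiction refl q
  permute T {1F} {0F} {2F} p q r = swap _ _ ↭-refl
  permute T {1F} {1F} p q r = contradiction refl p
  permute T {1F} {2F} {0F} p q r = rotate T 1F
  permute T {1F} {2F} {1F} p q r = contradiction refl q
  permute T {1F} {2F} {2F} p q r = contradiction refl r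
  permute T {2F} {0F} {0F} p q r = contradiction refl r
  permute T {2F} {0F} {1F} p q r = rotate T 2F
  permute T {2F} {0F} {2F} p q r = contradiction refl q
  permute T {2F} {1F} {0F} p q r = ↭-trans (rotate T 2F) (prep _ (swap _ _ ↭-refl))
  permute T {2F} {1F} {1F} p q r = contradiction refl r
  permute T {2F} {1F} {2F} p q r = contradiction refl q
  permute T {2F} {2F} p q r = contradiction refl p

  -- Pigeonhole: values of at most `c` throughout would sum to at most `c * length ts`.
  pick : ∀ {P : Triple → Set} (φ : Triple → ℕ) c ts → All P ts → c * length ts < sum (map φ ts) →
    ∃ λ T → ∃ λ ts′ → P T × All P ts′ × length ts ≡ suc (length ts′) ×
      flatten ts ↭ vertices T ++ flatten ts′ × c < φ T
  pick φ c [] _ h = contradiction (subst (_< 0) (*-zeroʳ c) h) λ ()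
  pick φ c (T ∷ ts) (p ∷ ps) h with suc c ≤? φ T
  ... | yes c<φ = T , ts , p , ps , refl , ↭-refl , c<φ
  ... | no c≮φ with pick φ c ts ps
        (+-cancelˡ-< c _ _ (≤-trans (subst (_< φ T + sum (map φ ts)) (*-suc c (length ts)) h)
                                    (+-monoˡ-≤ _ (≮⇒≥ c≮φ))))
  ... | T′ , ts′ , p′ , ps′ , len , perm , c<φ =
    T′ , T ∷ ts′ , p′ , p ∷ ps′ , cong suc len ,
    ↭-trans (++⁺ˡ (vertices T) perm) (shifts (vertices T) (vertices T′)) , c<φ

-- Triangles with a source, packings and edge counts

bit : Bool → ℕ
bit b = if b then 1 else 0

module Graph {V : Set} (A : V → V → Bool) where

  infix 4 _⟶_ _~_
  _⟶_ _~_ : V → V → Set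
  x ⟶ y = A x y ≡ true
  x ~ y = x ⟶ y ⊎ y ⟶ x

  ~-sym : ∀ {x y} → x ~ y → y ~ x
  ~-sym (inj₁ p) = inj₂ p
  ~-sym (inj₂ p) = inj₁ p

  _⟶?_ : ∀ x y → Dec (x ⟶ y)
  x ⟶? y = A x y ≟ᵇ true

  Source : V → V → V → Set
  Source x y z = x ⟶ y × x ⟶ z × y ~ z

  data Tri (x y z : V) : Set where
    source₁ : Source x y z → Tri x y z
    source₂ : Source y x z → Tri x y z
    source₃ : Source z x y → Tri x y z

  fromSource : ∀ {x y z} → x ⟶ y → x ⟶ z → y ~ z → Tri x y z
  fromSource p q r = source₁ (p , q , r)

  -- Whichever of `x` and `y` sends the edge between them is the source.
  toSink : ∀ {x y z} → x ⟶ z → y ⟶ z → x ~ y → Tri x y z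
  toSink p q (inj₁ r) = source₁ (r , p , inj₁ q)
  toSink p q (inj₂ r) = source₂ (r , q , inj₁ p)

  IsTri : Triple → Set
  IsTri T = Tri (T 0F) (T 1F) (T 2F)

  adjacent : ∀ T → IsTri T → ∀ t → T (next t) ~ T (next² t)
  adjacent T (source₁ (p , q , r)) 0F = r
  adjacent T (source₁ (p , q , r)) 1F = inj₂ q
  adjacent T (source₁ (p , q , r)) 2F = inj₁ p
  adjacent T (source₂ (p , q , r)) 0F = inj₁ q
  adjacent T (source₂ (p , q , r)) 1F = ~-sym r
  adjacent T (source₂ (p , q , r)) 2F = inj₂ p
  adjacent T (source₃ (p , q , r)) 0F = inj₂ q
  adjacent T (source₃ (p , q , r)) 1F = inj₁ p
  adjacent T (source₃ (p , q , r)) 2F = r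

  tri-swap : ∀ {x y z} → Tri x y z → Tri x z y
  tri-swap (source₁ (p , q , r)) = source₁ (q , p , ~-sym r)
  tri-swap (source₂ (p , q , r)) = source₃ (p , q , r)
  tri-swap (source₃ (p , q , r)) = source₂ (p , q , r)

  tri-cycle : ∀ {x y z} → Tri x y z → Tri y z x
  tri-cycle (source₁ (p , q , r)) = source₃ (p , q , r)
  tri-cycle (source₂ (p , q , r)) = source₁ (q , p , ~-sym r)
  tri-cycle (source₃ (p , q , r)) = source₂ (q , p , ~-sym r)

  tri-rotate : ∀ T → IsTri T → ∀ t → Tri (T t) (T (next t)) (T (next² t))
  tri-rotate T tri 0F = tri
  tri-rotate T tri 1F = tri-cycle tri
  tri-rotate T tri 2F = tri-cycle (tri-cycle tri)

  -- The permutation encodes both covering and disjointness: if `ws` has no repetition, neither has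
  -- `flatten ts`.
  Packing : List V → Set
  Packing ws = ∃ λ ts → All IsTri ts × flatten ts ↭ ws

  ∅ : Packing []
  ∅ = [] , [] , ↭-refl

  add : ∀ {x y z ws} → Tri x y z → Packing ws → Packing (x ∷ y ∷ z ∷ ws)
  add t (ts , ps , perm) = triple _ _ _ ∷ ts , t ∷ ps , prep _ (prep _ (prep _ perm))

  reorder : ∀ {ws ws′} → ws ↭ ws′ → Packing ws → Packing ws′
  reorder σ (ts , ps , perm) = ts , ps , ↭-trans perm σ

  extend : ∀ {ws vs ts} → All IsTri ts → ws ++ flatten ts ↭ vs → Packing ws → Packing vs
  extend {ts = ts} ps σ (us , qs , perm) =
    us ++ ts , All.++⁺ qs ps ,
    ↭-trans (subst (_↭ _) (sym (concatMap-++ vertices us ts)) (++⁺ʳ (flatten ts) perm)) σ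

  column : Triple → V → Subset 3
  column X v = tabulate λ a → A (X a) v

  bip : Triple → Triple → Bip
  bip X Y = tabulate λ t → column X (Y t)

  lookup-bip : ∀ X Y t → lookup (bip X Y) t ≡ column X (Y t)
  lookup-bip X Y = lookup∘tabulate (column X ∘ Y)

  column⇒edge : ∀ X {v i} → i ∈ₛ column X v → X i ⟶ v
  column⇒edge X {v} {i} = subst (_≡ true) (lookup∘tabulate (λ a → A (X a) v) i)

  bip⇒edge : ∀ X Y {i t} → bip X Y [ i ↦ t ] → X i ⟶ Y t
  bip⇒edge X Y {i} {t} h = column⇒edge X (subst (i ∈ₛ_) (lookup-bip X Y t) h)

  -- On `vertices T` this unfolds to the same sum as `edges (bip X T)`, so the two are used
  -- interchangeably.
  weight : Triple → List V → ℕ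
  weight X vs = sum (map (∣_∣ ∘ column X) vs)

  weight-++ : ∀ X us vs → weight X (us ++ vs) ≡ weight X us + weight X vs
  weight-++ X us vs = trans (cong sum (map-++ _ us vs)) (sum-++ (map _ us) (map _ vs))

  weight-↭ : ∀ X {us vs} → us ↭ vs → weight X us ≡ weight X vs
  weight-↭ X σ = sum-↭ (map⁺ _ σ)

  weight-vertices≤9 : ∀ X Y → weight X (vertices Y) ≤ 9
  weight-vertices≤9 X Y = +-mono-≤ (c 0F) (+-mono-≤ (c 1F) (+-mono-≤ (c 2F) z≤n))
    where
    c : ∀ t → ∣ column X (Y t) ∣ ≤ 3
    c t = ∣p∣≤n (column X (Y t))

  degree : List V → V → ℕ
  degree vs x = sum (map (bit ∘ A x) vs)

  -- Double counting: edges leaving `X` are grouped by head on the left and by tail on the right.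
  weight-degree : ∀ X vs → weight X vs ≡ degree vs (X 0F) + degree vs (X 1F) + degree vs (X 2F)
  weight-degree X [] = refl
  weight-degree X (v ∷ vs) = trans (cong₂ _+_ (size (A (X 0F) v) (A (X 1F) v) (A (X 2F) v)) (weight-degree X vs))
    (solve 6 (λ a b c p q r → (a :+ b :+ c) :+ (p :+ q :+ r) := (a :+ p) :+ (b :+ q) :+ (c :+ r)) refl
       (bit (A (X 0F) v)) (bit (A (X 1F) v)) (bit (A (X 2F) v)) _ _ _)
    where
    open +-*-Solver
    size : ∀ a b c → ∣ a ∷ b ∷ c ∷ [] ∣ ≡ bit a + bit b + bit c
    size false false false = refl
    size false false true  = refl
    size false true  false = refl
    size false true  true  = refl
    size true  false false = refl
    size true  false true  = refl
    size true  true  false = refl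
    size true  true  true  = refl

  open CommutativeMonoidSolver (++-commutativeMonoid {A = V}) using (solve; _⊜_; _⊕_)

  exchange : ∀ W T w → IsTri T → W (next w) ~ W (next² w) → Exchange (bip W T) w →
    Packing (vertices W ++ vertices T)
  exchange W T w T-tri adj (t , p , q , r , s) =
    reorder (↭-trans
      (solve 6 (λ w w′ w″ t t′ t″ → (w ⊕ t′ ⊕ t″ ⊕ w′ ⊕ w″ ⊕ t) ⊜ (w ⊕ w′ ⊕ w″ ⊕ t ⊕ t′ ⊕ t″)) ↭-refl
         ⟨ W w ⟩ ⟨ _ ⟩ ⟨ _ ⟩ ⟨ T t ⟩ ⟨ _ ⟩ ⟨ _ ⟩)
      (++⁺ (↭-sym (rotate W w)) (↭-sym (rotate T t))))
    (add (fromSource (bip⇒edge W T r) (bip⇒edge W T s) (adjacent T T-tri t))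
    (add (toSink (bip⇒edge W T p) (bip⇒edge W T q) adj) ∅))

  -- Stars and their rearrangements with one or two triangles

  record Star (I J : Triple) : Set where
    field
      linked      : ∀ i j → I i ~ J j
      -- Here `j` is the vertex of `J` left out.
      spread      : ∀ i j → Tri (I i) (J (next j)) (J (next² j))
      independent : ∀ i i′ → A (I i) (I i′) ≡ false

  module _ {I J : Triple} (star : Star I J) where
    open Star star

    -- Besides the given triangle, `i` takes the other two vertices of `T`, and `i″` the other two
    -- of `J`.
    weave : ∀ {T t j i i′} → IsTri T → i ≢ i′ → Dominates (bip I T) i t → Tri (I i′) (J j) (T t) →
      Packing (vertices I ++ vertices J ++ vertices T)
    weave {T} {t} {j} {i} {i′} T-tri i≢i′ (p , q) tri with third i i′ i≢i′
    ... | i″ , i≢i″ , i′≢i″ =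
      reorder (↭-trans
        (solve 9 (λ i i′ i″ j j′ j″ t t′ t″ →
             (i ⊕ t′ ⊕ t″ ⊕ i′ ⊕ j ⊕ t ⊕ i″ ⊕ j′ ⊕ j″)
           ⊜ (i ⊕ i′ ⊕ i″ ⊕ j ⊕ j′ ⊕ j″ ⊕ t ⊕ t′ ⊕ t″)) ↭-refl
           ⟨ _ ⟩ ⟨ _ ⟩ ⟨ _ ⟩ ⟨ _ ⟩ ⟨ _ ⟩ ⟨ _ ⟩ ⟨ _ ⟩ ⟨ _ ⟩ ⟨ _ ⟩)
        (↭-sym (++⁺ (permute I i≢i′ i≢i″ i′≢i″) (++⁺ (rotate J j) (rotate T t)))))
      (add (fromSource (bip⇒edge I T p) (bip⇒edge I T q) (adjacent T T-tri t))
      (add tri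
      (add (spread i″ j) ∅)))

    module _ {K T : Triple} (K-tri : IsTri K) (T-tri : IsTri T) where

      private
        M = bip I K
        F = bip I T
        G = bip J T
        H = bip K T

        Target : Set
        Target = Packing (vertices I ++ vertices J ++ vertices K ++ vertices T)

      -- Two vertices of `T` go to `j` and the third to `i′` and `k`; then `i` replaces `k` in `K`,
      -- and `i″` replaces `j` in `J`.
      augment-J : ∀ {i i′ j k t} → i ≢ i′ → Dominates M i k → M [ i′ ↦ k ] → F [ i′ ↦ t ] → H [ k ↦ t ] →
        Dominates G j t → Target
      augment-J {i} {i′} {j} {k} {t} i≢i′ (ik′ , ik″) i′k i′t kt (jt′ , jt″) with third i i′ i≢i′
      ... | i″ , i≢i″ , i′≢i″ =
        reorder (↭-trans
          (solve 12 (λ i i′ i″ j j′ j″ k k′ k″ t t′ t″ →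
               (j ⊕ t′ ⊕ t″ ⊕ i ⊕ k′ ⊕ k″ ⊕ i′ ⊕ k ⊕ t ⊕ i″ ⊕ j′ ⊕ j″)
             ⊜ (i ⊕ i′ ⊕ i″ ⊕ j ⊕ j′ ⊕ j″ ⊕ k ⊕ k′ ⊕ k″ ⊕ t ⊕ t′ ⊕ t″)) ↭-refl
             ⟨ _ ⟩ ⟨ _ ⟩ ⟨ _ ⟩ ⟨ _ ⟩ ⟨ _ ⟩ ⟨ _ ⟩ ⟨ _ ⟩ ⟨ _ ⟩ ⟨ _ ⟩ ⟨ _ ⟩ ⟨ _ ⟩ ⟨ _ ⟩)
          (↭-sym (++⁺ (permute I i≢i′ i≢i″ i′≢i″) (++⁺ (rotate J j) (++⁺ (rotate K k) (rotate T t))))))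
        (add (fromSource (bip⇒edge J T jt′) (bip⇒edge J T jt″) (adjacent T T-tri t))
        (add (fromSource (bip⇒edge I K ik′) (bip⇒edge I K ik″) (adjacent K K-tri k))
        (add (fromSource (bip⇒edge I K i′k) (bip⇒edge I T i′t) (inj₁ (bip⇒edge K T kt)))
        (add (spread i″ j) ∅))))

      -- Two vertices of `T` go to `k` and the third to `i′` and `j`; the replacements are as in
      -- `augment-J`.
      augment-K : ∀ {i i′ j k t} → i ≢ i′ → Dominates M i k → F [ i′ ↦ t ] → G [ j ↦ t ] →
        Dominates H k t → Target
      augment-K {i} {i′} {j} {k} {t} i≢i′ (ik′ , ik″) i′t jt (kt′ , kt″) with third i i′ i≢i′
      ... | i″ , i≢i″ , i′≢i″ =
        reorder (↭-trans
          (solve 12 (λ i i′ i″ j j′ j″ k k′ k″ t t′ t″ →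
               (k ⊕ t′ ⊕ t″ ⊕ i ⊕ k′ ⊕ k″ ⊕ i′ ⊕ j ⊕ t ⊕ i″ ⊕ j′ ⊕ j″)
             ⊜ (i ⊕ i′ ⊕ i″ ⊕ j ⊕ j′ ⊕ j″ ⊕ k ⊕ k′ ⊕ k″ ⊕ t ⊕ t′ ⊕ t″)) ↭-refl
             ⟨ _ ⟩ ⟨ _ ⟩ ⟨ _ ⟩ ⟨ _ ⟩ ⟨ _ ⟩ ⟨ _ ⟩ ⟨ _ ⟩ ⟨ _ ⟩ ⟨ _ ⟩ ⟨ _ ⟩ ⟨ _ ⟩ ⟨ _ ⟩)
          (↭-sym (++⁺ (permute I i≢i′ i≢i″ i′≢i″) (++⁺ (rotate J j) (++⁺ (rotate K k) (rotate T t))))))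
        (add (fromSource (bip⇒edge K T kt′) (bip⇒edge K T kt″) (adjacent T T-tri t))
        (add (fromSource (bip⇒edge I K ik′) (bip⇒edge I K ik″) (adjacent K K-tri k))
        (add (toSink (bip⇒edge I T i′t) (bip⇒edge J T jt) (linked i′ j))
        (add (spread i″ j) ∅))))

      -- `T` is split three ways: `s` goes to the companions of `k`, `t` to `i′` and `k`, and `r` to
      -- `i″` and `j`.
      augment-detour : ∀ {i″ j t s r} → vertices T ↭ T t ∷ T s ∷ T r ∷ [] → (∀ i → F [ i ↦ t ]) →
        F [ i″ ↦ r ] → G [ j ↦ r ] → Detour M H t s i″ → Target
      augment-detour {i″} {j} {t} {s} {r} σ it i″r jr (i′ , k , i′≢i″ , i′k , kt , k′s , k″s)
        with third i′ i″ i′≢i″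
      ... | i , i′≢i , i″≢i =
        reorder (↭-trans
          (solve 12 (λ i i′ i″ j j′ j″ k k′ k″ t s r →
               (k′ ⊕ k″ ⊕ s ⊕ i′ ⊕ k ⊕ t ⊕ i″ ⊕ j ⊕ r ⊕ i ⊕ j′ ⊕ j″)
             ⊜ (i′ ⊕ i″ ⊕ i ⊕ j ⊕ j′ ⊕ j″ ⊕ k ⊕ k′ ⊕ k″ ⊕ t ⊕ s ⊕ r)) ↭-refl
             ⟨ _ ⟩ ⟨ _ ⟩ ⟨ _ ⟩ ⟨ _ ⟩ ⟨ _ ⟩ ⟨ _ ⟩ ⟨ _ ⟩ ⟨ _ ⟩ ⟨ _ ⟩ ⟨ _ ⟩ ⟨ _ ⟩ ⟨ _ ⟩)
          (↭-sym (++⁺ (permute I i′≢i″ i′≢i i″≢i) (++⁺ (rotate J j) (++⁺ (rotate K k) σ)))))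
        (add (toSink (bip⇒edge K T k′s) (bip⇒edge K T k″s) (adjacent K K-tri k))
        (add (fromSource (bip⇒edge I K i′k) (bip⇒edge I T (it i′)) (inj₁ (bip⇒edge K T kt)))
        (add (toSink (bip⇒edge I T i″r) (bip⇒edge J T jr) (linked i″ j))
        (add (spread i j) ∅))))

      -- With f, g, h the numbers of edges into T from I, J, K: if g ≥ 7, then f + h ≥ 10 and two
      -- vertices of T can be given to J.  Otherwise h ≥ 7 and two of them are given to K, at a
      -- third vertex hit by I and J, unless f = 5, g = 6 and h = 8: then T is split three ways.
      augment : 7 ≤ edges M → edges F ≤ 6 → 19 ≤ edges F + edges G + edges H → Target
      augment 7≤M F≤6 19≤ with 7 ≤? edges G
      ... | yes 7≤G
        with t , 4≤ ← heavy-column F H (+-cancelʳ-≤ 9 10 _ (≤-trans 19≤ (≤-trans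
               (≤-reflexive (trans (+-assoc (edges F) _ _) (trans (cong (edges F +_) (+-comm (edges G) _)) (sym (+-assoc (edges F) _ _)))))
               (+-monoʳ-≤ (edges F + edges H) (edges≤9 G)))))
        with k , i′ , i , kt , i′t , i≢i′ , i′k , dom ← crossing M 7≤M (lookup F t) (lookup H t) 4≤
        with _ , j , _ , _ , jdom ← crossing-target G 7≤G t
        = augment-J {k = k} {t = t} i≢i′ dom i′k i′t kt jdom
      ... | no G≱7 with 9 ≤? edges H
      -- Now f + g ≥ 10, and a column of total at least 4 has at most 3 edges from either side, so
      -- both `I` and `J` hit `t`.
      ... | yes 9≤H
        with t , 4≤ ← heavy-column F G (+-cancelʳ-≤ 9 10 _ (≤-trans 19≤ (+-monoʳ-≤ (edges F + edges G) (edges≤9 H))))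
        with i′ , i′t ← inhabited (lookup F t) (+-cancelʳ-≤ 3 1 _ (≤-trans 4≤ (+-monoʳ-≤ _ (∣p∣≤n (lookup G t)))))
        with j , jt ← inhabited (lookup G t) (+-cancelˡ-≤ 3 1 _ (≤-trans 4≤ (+-monoˡ-≤ _ (∣p∣≤n (lookup F t)))))
        with k , i , i≢i′ , dom ← dominator-avoiding M 7≤M i′
        = augment-K {k = k} {t = t} i≢i′ dom i′t jt (full H 9≤H k (next t) , full H 9≤H k (next² t))
      ... | no H≱9 with any? (λ t → heavy? ∣ lookup F t ∣ ∣ lookup G t ∣)
      -- Here h ≥ 19 - 6 - 6 = 7. Two vertices of `I` hit `t`, so one of them differs from `i`.
      ... | yes (t , 2≤F , 1≤G)
        with j , jt ← inhabited (lookup G t) 1≤G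
        with _ , k , _ , _ , kdom ← crossing-target H
               (+-cancelˡ-≤ 12 7 _ (≤-trans 19≤ (+-monoˡ-≤ (edges H) (+-mono-≤ F≤6 (≤-pred (≰⇒> G≱7)))))) t
        with _ , i , _ , _ , dom ← crossing-target M 7≤M k
        with i′ , i′t , i≢i′ ← second-element (lookup F t) 2≤F i
        = augment-K {k = k} {t = t} i≢i′ dom i′t jt kdom
      -- Now h ≤ 8 gives f + g ≥ 11; the reverse bound f + g ≤ 11 then gives h ≥ 8, as `detour`
      -- requires.
      ... | no light
        with F+G≤11 , t , 3≤F , (1≤F′ , 1≤G′) , (1≤F″ , 1≤G″) ← unbalanced F G (λ t h → light (t , h))
               (+-cancelʳ-≤ 8 11 _ (≤-trans 19≤ (+-monoʳ-≤ (edges F + edges G) (≤-pred (≰⇒> H≱9)))))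
               F≤6 (≤-pred (≰⇒> G≱7))
        with i₁ , i₁t′ ← inhabited (lookup F (next t)) (subst (1 ≤_) (lookup-map (next t) ∣_∣ F) 1≤F′)
        with j₁ , j₁t′ ← inhabited (lookup G (next t)) (subst (1 ≤_) (lookup-map (next t) ∣_∣ G) 1≤G′)
        with i₂ , i₂t″ ← inhabited (lookup F (next² t)) (subst (1 ≤_) (lookup-map (next² t) ∣_∣ F) 1≤F″)
        with j₂ , j₂t″ ← inhabited (lookup G (next² t)) (subst (1 ≤_) (lookup-map (next² t) ∣_∣ G) 1≤G″)
        with detour H (+-cancelˡ-≤ 11 8 _ (≤-trans 19≤ (+-monoˡ-≤ (edges H) F+G≤11))) M 7≤M t i₁ i₂
      ... | inj₁ d = augment-detour (rotate T t) (all-in (lookup F t) (subst (3 ≤_) (lookup-map t ∣_∣ F) 3≤F)) i₂t″ j₂t″ d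
      ... | inj₂ d = augment-detour (↭-trans (rotate T t) (prep _ (swap _ _ ↭-refl))) (all-in (lookup F t) (subst (3 ≤_) (lookup-map t ∣_∣ F) 3≤F)) i₁t′ j₁t′ d

-- Completing an almost perfect packing

module Completion {V : Set} (A : V → V → Bool) (loopless : ∀ x → A x x ≡ false)
  (vs : List V) (m : ℕ) (|vs| : length vs ≡ 3 * m)
  (degree≥ : ∀ x → 2 * m ≤ Graph.degree A vs x) where

  open Graph A

  _~?_ : ∀ x y → Dec (x ~ y)
  x ~? y = x ⟶? y ⊎-dec y ⟶? x

  number-of-triples : ∀ c ws ts → length ws ≡ 3 * c → ws ++ flatten ts ↭ vs → m ≡ c + length ts
  number-of-triples c ws ts |ws| σ = *-cancelˡ-≡ m (c + length ts) 3 (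
    trans (sym |vs|) (trans (sym (↭-length σ)) (trans (length-++ ws)
      (trans (cong₂ _+_ |ws| (length-flatten ts)) (sym (*-distribˡ-+ 3 c (length ts)))))))

  weight-flatten : ∀ X ts → weight X (flatten ts) ≡ sum (map (weight X ∘ vertices) ts)
  weight-flatten X [] = refl
  weight-flatten X (T ∷ ts) =
    trans (weight-++ X (vertices T) (flatten ts)) (cong (weight X (vertices T) +_) (weight-flatten X ts))

  weight-total : ∀ X ws {us} → ws ++ us ↭ vs → 6 * m ≤ weight X ws + weight X us
  weight-total X ws {us} σ = ≤-trans
    (≤-trans (≤-reflexive (solve 1 (λ m → con 6 :* m := con 2 :* m :+ con 2 :* m :+ con 2 :* m) refl m))
             (+-mono-≤ (+-mono-≤ (degree≥ (X 0F)) (degree≥ (X 1F))) (degree≥ (X 2F))))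
    (≤-reflexive (trans (sym (weight-degree X vs)) (trans (sym (weight-↭ X σ)) (weight-++ X ws us))))
    where open +-*-Solver

  column≡ : ∀ X v i → lookup (column X v) i ≡ A (X i) v
  column≡ X v = lookup∘tabulate (λ a → A (X a) v)

  column-self : ∀ X t → ∣ column X (X t) ∣ ≤ 2
  column-self X t = missing-one _ t (trans (column≡ X (X t) t) (loopless (X t)))

  column-self-missing : ∀ X {i t} → i ≢ t → ¬ X i ⟶ X t → ∣ column X (X t) ∣ ≤ 1
  column-self-missing X {i} {t} i≢t ¬it = missing-two _ i t i≢t
    (trans (column≡ X (X t) i) (¬-not ¬it)) (trans (column≡ X (X t) t) (loopless (X t)))

  weight-self≤6 : ∀ X → weight X (vertices X) ≤ 6
  weight-self≤6 X = +-mono-≤ (column-self X 0F) (+-mono-≤ (column-self X 1F) (+-mono-≤ (column-self X 2F) z≤n))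

  weight-none : ∀ X Y → (∀ i j → ¬ X i ⟶ Y j) → weight X (vertices Y) ≤ 0
  weight-none X Y none = +-mono-≤ (c 0F) (+-mono-≤ (c 1F) (+-mono-≤ (c 2F) z≤n))
    where
    c : ∀ t → ∣ column X (Y t) ∣ ≤ 0
    c t = empty _ λ i → none i t ∘ column⇒edge X

  -- Each vertex receives at most two edges from within `W`. If `W 0F` is not a source, a vertex
  -- that it misses receives at most one.
  tri-or-light : ∀ W → W 1F ~ W 2F → IsTri W ⊎ weight W (vertices W) ≤ 5
  tri-or-light W r = decide (W 0F ⟶? W 2F) (W 0F ⟶? W 1F)
    where
    decide : Dec (W 0F ⟶ W 2F) → Dec (W 0F ⟶ W 1F) → IsTri W ⊎ weight W (vertices W) ≤ 5
    decide (yes q) (yes p) = inj₁ (fromSource p q r)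
    decide (no ¬q) _ = inj₂ (+-mono-≤ (column-self W 0F)
      (+-mono-≤ (column-self W 1F) (+-mono-≤ (column-self-missing W (λ ()) ¬q) z≤n)))
    decide (yes _) (no ¬p) = inj₂ (+-mono-≤ (column-self W 0F)
      (+-mono-≤ (column-self-missing W (λ ()) ¬p) (+-mono-≤ (column-self W 2F) z≤n)))

  HeavyTarget : Triple → List V → Set
  HeavyTarget W ws = ∃ λ T → ∃ λ ts → IsTri T × All IsTri ts ×
    ws ++ vertices T ++ flatten ts ↭ vs × 7 ≤ edges (bip W T)

  -- The degrees in `W` sum to at least `6 * m`, that is `6 * c` plus 6 for each triangle. Fewer
  -- than `6 * c` of these edges go to `ws`, so some triangle receives more than 6.
  light⇒heavy-target : ∀ c W ws {ts} → length ws ≡ 3 * c → All IsTri ts → ws ++ flatten ts ↭ vs →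
    weight W ws < 6 * c → HeavyTarget W ws
  light⇒heavy-target c W ws {ts} |ws| ps σ light =
    let T , ts′ , p , ps′ , _ , τ , 7≤ = pick (weight W ∘ vertices) 6 ts ps
          (subst (6 * length ts <_) (weight-flatten W ts)
            (+-cancelˡ-< (weight W ws) _ _ (<-≤-trans (+-monoˡ-< (6 * length ts) light)
              (≤-trans (≤-reflexive (trans (sym (*-distribˡ-+ 6 c (length ts)))
                                           (cong (6 *_) (sym (number-of-triples c ws ts |ws| σ)))))
                       (weight-total W ws σ)))))
    in T , ts′ , p , ps′ , ↭-trans (++⁺ˡ ws (↭-sym τ)) σ , 7≤

  -- Whichever `w` an exchange singles out, the other two vertices are adjacent, so the exchange can
  -- be carried out.
  complete-triple : ∀ W {ts} → (∀ w → W (next w) ~ W (next² w)) → All IsTri ts →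
    vertices W ++ flatten ts ↭ vs → Packing vs
  complete-triple W adj ps σ = decide (tri-or-light W (adj 0F))
    where
    absorb : HeavyTarget W (vertices W) → Packing vs
    absorb (T , ts , T-tri , ps , τ , 7≤) =
      let w , e = exchangeable (bip W T) 7≤
      in extend {ws = vertices W ++ vertices T} ps τ (exchange W T w T-tri (adj w) e)

    decide : IsTri W ⊎ weight W (vertices W) ≤ 5 → Packing vs
    decide (inj₁ tri) = extend ps σ (add tri ∅)
    decide (inj₂ ≤5) = absorb (light⇒heavy-target 1 W (vertices W) refl ps σ (s≤s ≤5))

  -- Completing a star

  combined : Triple → Triple → Triple → Triple → ℕ
  combined X Y Z T = weight X (vertices T) + weight Y (vertices T) + weight Z (vertices T)

  sum-combined : ∀ X Y Z ts → sum (map (combined X Y Z) ts) ≡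
    weight X (flatten ts) + weight Y (flatten ts) + weight Z (flatten ts)
  sum-combined X Y Z [] = refl
  sum-combined X Y Z (T ∷ ts)
    rewrite sum-combined X Y Z ts
          | weight-++ X (vertices T) (flatten ts)
          | weight-++ Y (vertices T) (flatten ts)
          | weight-++ Z (vertices T) (flatten ts)
    = solve 6 (λ a b c p q r → (a :+ b :+ c) :+ (p :+ q :+ r) := (a :+ p) :+ (b :+ q) :+ (c :+ r)) refl
        (weight X (vertices T)) (weight Y (vertices T)) (weight Z (vertices T))
        (weight X (flatten ts)) (weight Y (flatten ts)) (weight Z (flatten ts))
    where open +-*-Solver

  module _ {I J : Triple} (star : Star I J) where
    open Star star

    -- Some `i′` also hits `t` and is linked to `j`, so `t` is the sink of a triangle, while another
    -- `i` takes the rest of `T`.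
    weave-into : ∀ T {j t} → IsTri T → 7 ≤ edges (bip I T) → J j ⟶ T t →
      Packing (vertices I ++ vertices J ++ vertices T)
    weave-into T {j} {t} T-tri 7≤ jt =
      let i′ , i , i≢i′ , i′t , dom = crossing-target (bip I T) 7≤ t
      in weave star {T = T} {t = t} T-tri i≢i′ dom (toSink (bip⇒edge I T i′t) jt (linked i′ j))

    -- `crossing` applied to the in-neighbours of `J j` gives the triangle of `i′`, `k` and `j`.
    weave-from : ∀ K j → IsTri K → 7 ≤ edges (bip I K) → 5 ≤ ∣ column I (J j) ∣ + ∣ column K (J j) ∣ →
      Packing (vertices I ++ vertices J ++ vertices K)
    weave-from K j K-tri 7≤ 5≤ =
      let k , i′ , i , kj , i′j , i≢i′ , i′k , dom =
            crossing (bip I K) 7≤ (column I (J j)) (column K (J j)) (≤-trans (n≤1+n 4) 5≤)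
      in weave star {T = K} {t = k} K-tri i≢i′ dom
           (fromSource (column⇒edge I {i = i′} i′j) (bip⇒edge I K i′k) (inj₂ (column⇒edge K {i = k} kj)))

    -- 51 = 9 + 9 + 6 + 9 + 6 + 12 bounds the number of edges inside I ∪ J ∪ K; the last summand
    -- accounts for those from I ∪ K to J.
    combined-average : ∀ K ts → vertices I ++ vertices J ++ vertices K ++ flatten ts ↭ vs →
      (∀ j → ∣ column I (J j) ∣ + ∣ column K (J j) ∣ ≤ 4) → weight J (vertices K) ≤ 0 →
      18 * length ts < sum (map (combined I J K) ts)
    combined-average K ts σ few none =
      subst (18 * length ts <_) (sym (sum-combined I J K ts))
        -- The three triples have total outdegree at least `18 * m`, which is `54 + 18 * length ts`;
        -- of the surplus 3 over 51, one unit gives strictness.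
        (+-cancelˡ-≤ 51 _ _ (≤-trans (≤-trans (n≤1+n _) (≤-trans (n≤1+n _) (≤-reflexive budget)))
          (≤-trans (+-mono-≤ (+-mono-≤ (total I) (total J)) (total K)) bound)))
      where
      open +-*-Solver
      total : ∀ X → 6 * m ≤ weight X (vertices I) + (weight X (vertices J) + (weight X (vertices K) + weight X (flatten ts)))
      total X = ≤-trans (weight-total X (vertices I) σ) (+-monoʳ-≤ (weight X (vertices I))
        (≤-reflexive (trans (weight-++ X (vertices J) (vertices K ++ flatten ts))
          (cong (weight X (vertices J) +_) (weight-++ X (vertices K) (flatten ts))))))

      budget : 54 + 18 * length ts ≡ 6 * m + 6 * m + 6 * m
      budget rewrite number-of-triples 3 (vertices I ++ vertices J ++ vertices K) ts refl σ =
        solve 1 (λ l → con 54 :+ con 18 :* l :=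
          con 6 :* (con 3 :+ l) :+ con 6 :* (con 3 :+ l) :+ con 6 :* (con 3 :+ l)) refl (length ts)

      s = weight I (vertices J)
      p = weight K (vertices J)
      a = weight I (flatten ts)
      b = weight J (flatten ts)
      c = weight K (flatten ts)

      s+p≤12 : s + p ≤ 12
      s+p≤12 = ≤-trans
        (≤-reflexive (solve 6 (λ a b c d e f →
           (a :+ (b :+ (c :+ con 0))) :+ (d :+ (e :+ (f :+ con 0))) := (a :+ d) :+ ((b :+ e) :+ (c :+ f))) refl
           (∣ column I (J 0F) ∣) (∣ column I (J 1F) ∣) (∣ column I (J 2F) ∣)
           (∣ column K (J 0F) ∣) (∣ column K (J 1F) ∣) (∣ column K (J 2F) ∣)))
        (+-mono-≤ (few 0F) (+-mono-≤ (few 1F) (few 2F)))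

      bound : weight I (vertices I) + (s + (weight I (vertices K) + a)) +
              (weight J (vertices I) + (weight J (vertices J) + (weight J (vertices K) + b))) +
              (weight K (vertices I) + (p + (weight K (vertices K) + c))) ≤ 51 + (a + b + c)
      bound = ≤-trans
        (+-mono-≤ (+-mono-≤
          (+-mono-≤ (weight-none I I λ i i′ e → contradiction (trans (sym e) (independent i i′)) λ ())
            (+-monoʳ-≤ s (+-monoˡ-≤ a (weight-vertices≤9 I K))))
          (+-mono-≤ (weight-vertices≤9 J I) (+-mono-≤ (weight-self≤6 J) (+-monoˡ-≤ b none))))
          (+-mono-≤ (weight-vertices≤9 K I) (+-monoʳ-≤ p (+-monoˡ-≤ c (weight-self≤6 K)))))
        (≤-trans
          (≤-reflexive (solve 5 (λ s p a b c →
             (con 0 :+ (s :+ (con 9 :+ a))) :+ (con 9 :+ (con 6 :+ (con 0 :+ b))) :+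
             (con 9 :+ (p :+ (con 6 :+ c))) := (s :+ p) :+ (con 39 :+ (a :+ b :+ c))) refl s p a b c))
          (+-monoˡ-≤ (39 + (a + b + c)) s+p≤12))

    complete-star : ∀ {ts} → All IsTri ts → vertices I ++ vertices J ++ flatten ts ↭ vs → Packing vs
    -- `I` sends no edge to itself and at most 9 to `J`, fewer than 6 * 2.
    complete-star ps σ = absorb (light⇒heavy-target 2 I (vertices I ++ vertices J) refl ps σ
      (s≤s (≤-trans (≤-reflexive (weight-++ I (vertices I) (vertices J)))
        (≤-trans (+-mono-≤ (weight-none I I λ i i′ e → contradiction (trans (sym e) (independent i i′)) λ ())
                           (weight-vertices≤9 I J)) (m≤m+n 9 2)))))
      where
      absorb : HeavyTarget I (vertices I ++ vertices J) → Packing vs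
      absorb (K , ts , K-tri , ps , τ , 7≤M) =
        dense? (any? λ j → 5 ≤? ∣ column I (J j) ∣ + ∣ column K (J j) ∣)
        where
        fourth : (∀ j k → ¬ J j ⟶ K k) →
          (∃ λ T → ∃ λ us → IsTri T × All IsTri us × length ts ≡ suc (length us) ×
            flatten ts ↭ vertices T ++ flatten us × 18 < combined I J K T) → Packing vs
        fourth ¬jk (T , us , T-tri , qs , _ , υ , 19≤) = decide (7 ≤? edges (bip I T))
          where
          sparse? : Dec (∃ λ j → ∃ λ t → J j ⟶ T t) → 7 ≤ edges (bip I T) → Packing vs
          -- `I`, `J` and `T` are repacked, and `K` is kept as a triangle.
          sparse? (yes (j , t , jt)) 7≤f =
            extend {ws = vertices I ++ vertices J ++ vertices T} (_∷_ {x = K} K-tri qs)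
              (↭-trans (++⁺ˡ (vertices I ++ vertices J)
                 (↭-trans (shifts (vertices T) (vertices K)) (++⁺ˡ (vertices K) (↭-sym υ)))) τ)
              (weave-into T T-tri 7≤f jt)
          -- With nothing from `J`, at most 9 + 0 + 9 = 18 edges enter `T`.
          sparse? (no ¬jt) _ = contradiction 19≤ (<⇒≱ (s≤s (+-mono-≤ (+-mono-≤
            (weight-vertices≤9 I T) (weight-none J T λ j t h → ¬jt (j , t , h))) (weight-vertices≤9 K T))))

          decide : Dec (7 ≤ edges (bip I T)) → Packing vs
          decide (yes 7≤f) = sparse? (any? λ j → any? λ t → J j ⟶? T t) 7≤f
          decide (no f≱7) =
            extend {ws = vertices I ++ vertices J ++ vertices K ++ vertices T} qs
              (↭-trans (++⁺ˡ (vertices I ++ vertices J ++ vertices K) (↭-sym υ)) τ)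
              (augment star {K} {T} K-tri T-tri 7≤M (≤-pred (≰⇒> f≱7)) 19≤)

        sparse? : (∀ j → ∣ column I (J j) ∣ + ∣ column K (J j) ∣ ≤ 4) →
          Dec (∃ λ j → ∃ λ k → J j ⟶ K k) → Packing vs
        sparse? few (yes (j , k , jk)) =
          extend {ws = vertices I ++ vertices J ++ vertices K} ps τ (weave-into K K-tri 7≤M jk)
        sparse? few (no ¬jk) = fourth (λ j k h → ¬jk (j , k , h)) (pick (combined I J K) 18 ts ps
          (combined-average K ts τ few (weight-none J K λ j k h → ¬jk (j , k , h))))

        dense? : Dec (∃ λ j → 5 ≤ ∣ column I (J j) ∣ + ∣ column K (J j) ∣) → Packing vs
        dense? (yes (j , 5≤)) = extend {ws = vertices I ++ vertices J ++ vertices K} ps τ (weave-from K j K-tri 7≤M 5≤)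
        dense? (no ¬5≤) =
          sparse? (λ j → ≤-pred (≰⇒> λ h → ¬5≤ (j , h))) (any? λ j → any? λ k → J j ⟶? K k)

  open CommutativeMonoidSolver (++-commutativeMonoid {A = V}) using (solve; _⊜_; _⊕_)

  -- From a leftover path to a packing

  complete-path : ∀ W {ts} → W 0F ~ W 1F → W 1F ~ W 2F → All IsTri ts → vertices W ++ flatten ts ↭ vs → Packing vs
  complete-path W xy yz ps σ = decide (tri-or-light W yz)
    where
    -- The last alternative of `exchangeable-at-end`. Any link among x, z, a yields a leftover
    -- triple of pairwise adjacent vertices; without one there is a star.
    module Stuck {T ts t} (T-tri : IsTri T) (ps : All IsTri ts) (τ : vertices W ++ vertices T ++ flatten ts ↭ vs)
      (y→ : ∀ s → bip W T [ 1F ↦ s ]) (x→ : Dominates (bip W T) 0F t) (z→ : Dominates (bip W T) 2F t) where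
      x = W 0F
      y = W 1F
      z = W 2F
      a = T t
      b = T (next t)
      c = T (next² t)

      abc : Tri a b c
      abc = tri-rotate T T-tri t

      bc : b ~ c
      bc = adjacent (triple a b c) abc 0F
      ca : c ~ a
      ca = adjacent (triple a b c) abc 1F
      ab : a ~ b
      ab = adjacent (triple a b c) abc 2F

      ρ : x ∷ y ∷ z ∷ a ∷ b ∷ c ∷ flatten ts ↭ vs
      ρ = ↭-trans (++⁺ˡ (vertices W) (++⁺ʳ (flatten ts) (↭-sym (rotate T t)))) τ

      y⟶_ : ∀ s → y ⟶ T s
      y⟶ s = bip⇒edge W T (y→ s)

      ya = y⟶ t
      yb = y⟶ next t
      yc = y⟶ next² t

      x⟶b = bip⇒edge W T (proj₁ x→)
      x⟶c = bip⇒edge W T (proj₂ x→)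
      z⟶b = bip⇒edge W T (proj₁ z→)
      z⟶c = bip⇒edge W T (proj₂ z→)

      star : ¬ x ~ z → ¬ z ~ a → ¬ x ~ a → Star (triple x z a) (triple y b c)
      star ¬xz ¬za ¬xa = record { linked = linked ; spread = spread ; independent = independent }
        where
        I = triple x z a
        J = triple y b c
        linked : ∀ i j → I i ~ J j
        linked 0F 0F = xy
        linked 0F 1F = inj₁ x⟶b
        linked 0F 2F = inj₁ x⟶c
        linked 1F 0F = ~-sym yz
        linked 1F 1F = inj₁ z⟶b
        linked 1F 2F = inj₁ z⟶c
        linked 2F 0F = inj₂ ya
        linked 2F 1F = ab
        linked 2F 2F = ~-sym ca
        spread : ∀ i j → Tri (I i) (J (next j)) (J (next² j))
        spread 0F 0F = fromSource x⟶b x⟶c bc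
        spread 0F 1F = tri-swap (toSink x⟶c yc xy)
        spread 0F 2F = toSink x⟶b yb xy
        spread 1F 0F = fromSource z⟶b z⟶c bc
        spread 1F 1F = tri-swap (toSink z⟶c yc (~-sym yz))
        spread 1F 2F = toSink z⟶b yb (~-sym yz)
        spread 2F 0F = abc
        spread 2F 1F = source₃ (ya , yc , ~-sym ca)
        spread 2F 2F = source₂ (ya , yb , ab)
        independent : ∀ i i′ → A (I i) (I i′) ≡ false
        independent 0F 0F = loopless x
        independent 0F 1F = ¬-not (¬xz ∘ inj₁)
        independent 0F 2F = ¬-not (¬xa ∘ inj₁)
        independent 1F 0F = ¬-not (¬xz ∘ inj₂)
        independent 1F 1F = loopless z
        independent 1F 2F = ¬-not (¬za ∘ inj₁)
        independent 2F 0F = ¬-not (¬xa ∘ inj₂)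
        independent 2F 1F = ¬-not (¬za ∘ inj₂)
        independent 2F 2F = loopless a

      finish : Packing vs
      finish = decide (x ~? z) (z ~? a) (x ~? a)
        where
        decide : Dec (x ~ z) → Dec (z ~ a) → Dec (x ~ a) → Packing vs
        decide (yes xz) _ _ = complete-triple W (λ { 0F → yz ; 1F → ~-sym xz ; 2F → xy }) (_∷_ {x = T} T-tri ps) τ
        -- The triangle abc is traded for xbc, leaving y, z, a; the next case is its mirror image.
        decide (no _) (yes za) _ =
          complete-triple (triple y z a) (λ { 0F → za ; 1F → inj₂ ya ; 2F → yz })
            (_∷_ {x = triple x b c} (fromSource x⟶b x⟶c bc) ps)
            (↭-trans (solve 7 (λ x y z a b c r → (y ⊕ z ⊕ a ⊕ x ⊕ b ⊕ c ⊕ r) ⊜ (x ⊕ y ⊕ z ⊕ a ⊕ b ⊕ c ⊕ r)) ↭-refl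
              ⟨ x ⟩ ⟨ y ⟩ ⟨ z ⟩ ⟨ a ⟩ ⟨ b ⟩ ⟨ c ⟩ (flatten ts)) ρ)
        decide (no _) (no _) (yes xa) =
          complete-triple (triple y x a) (λ { 0F → xa ; 1F → inj₂ ya ; 2F → ~-sym xy })
            (_∷_ {x = triple z b c} (fromSource z⟶b z⟶c bc) ps)
            (↭-trans (solve 7 (λ x y z a b c r → (y ⊕ x ⊕ a ⊕ z ⊕ b ⊕ c ⊕ r) ⊜ (x ⊕ y ⊕ z ⊕ a ⊕ b ⊕ c ⊕ r)) ↭-refl
              ⟨ x ⟩ ⟨ y ⟩ ⟨ z ⟩ ⟨ a ⟩ ⟨ b ⟩ ⟨ c ⟩ (flatten ts)) ρ)
        decide (no ¬xz) (no ¬za) (no ¬xa) = complete-star (star ¬xz ¬za ¬xa) ps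
            (↭-trans (solve 7 (λ x y z a b c r → (x ⊕ z ⊕ a ⊕ y ⊕ b ⊕ c ⊕ r) ⊜ (x ⊕ y ⊕ z ⊕ a ⊕ b ⊕ c ⊕ r)) ↭-refl
              ⟨ x ⟩ ⟨ y ⟩ ⟨ z ⟩ ⟨ a ⟩ ⟨ b ⟩ ⟨ c ⟩ (flatten ts)) ρ)

    absorb : HeavyTarget W (vertices W) → Packing vs
    absorb (T , ts , T-tri , ps , τ , 7≤) = decide (exchangeable-at-end (bip W T) 7≤)
      where
      decide : Exchange (bip W T) 0F ⊎ Exchange (bip W T) 2F ⊎
        (∃ λ t → (∀ s → bip W T [ 1F ↦ s ]) × Dominates (bip W T) 0F t × Dominates (bip W T) 2F t) → Packing vs
      -- Singling out an end of the path leaves the middle and the other end, which are adjacent.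
      decide (inj₁ e) = extend {ws = vertices W ++ vertices T} ps τ (exchange W T 0F T-tri yz e)
      decide (inj₂ (inj₁ e)) = extend {ws = vertices W ++ vertices T} ps τ (exchange W T 2F T-tri xy e)
      decide (inj₂ (inj₂ (t , y→ , x→ , z→))) = Stuck.finish {T} {ts} {t} T-tri ps τ y→ x→ z→

    decide : IsTri W ⊎ weight W (vertices W) ≤ 5 → Packing vs
    decide (inj₁ tri) = extend ps σ (add tri ∅)
    decide (inj₂ ≤5) = absorb (light⇒heavy-target 1 W (vertices W) refl ps σ (s≤s ≤5))

-- Deleting edges one at a time

Unique-resp-↭ : ∀ {V : Set} {xs ys : List V} → xs ↭ ys → Unique xs → Unique ys
Unique-resp-↭ {V} σ = Permutationₛ.Unique-resp-↭ (setoid V) (↭⇒↭ₛ σ)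

module EdgeRemoval {n : ℕ} where

  Graph′ : Set
  Graph′ = Fin n → Fin n → Bool

  addEdge : Fin n → Fin n → Graph′ → Graph′
  addEdge u v A x y = A x y ∨ (does (x ≟ᶠ u) ∧ does (y ≟ᶠ v))

  module _ (A : Graph′) {u v : Fin n} (u≢v : u ≢ v) where

    A⁺ : Graph′
    A⁺ = addEdge u v A

    open Graph A
    module G⁺ = Graph A⁺

    New : Fin n → Fin n → Set
    New x y = x ≡ u × y ≡ v

    old-or-new : ∀ {x y} → x G⁺.⟶ y → x ⟶ y ⊎ New x y
    old-or-new {x} {y} e with A x y | x ≟ᶠ u | y ≟ᶠ v
    ... | true | _ | _ = inj₁ refl
    ... | false | yes p | yes q = inj₂ (p , q)

    old-or-new-link : ∀ {x y} → x G⁺.~ y → x ~ y ⊎ New x y ⊎ New y x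
    old-or-new-link (inj₁ p) = Sum.map inj₁ inj₁ (old-or-new p)
    old-or-new-link (inj₂ p) = Sum.map inj₂ inj₂ (old-or-new p)

    irreflexive⁺ : (∀ x → A x x ≡ false) → ∀ x → A⁺ x x ≡ false
    irreflexive⁺ irreflexive x with A x x | irreflexive x | x ≟ᶠ u | x ≟ᶠ v
    ... | false | _ | yes p | yes q = contradiction (trans (sym p) q) u≢v
    ... | false | _ | yes _ | no _ = refl
    ... | false | _ | no _ | _ = refl

    degree⁺ : ∀ vs x → degree vs x ≤ G⁺.degree vs x
    degree⁺ [] x = z≤n
    degree⁺ (y ∷ vs) x = +-mono-≤ (bit-∨ (A x y) _) (degree⁺ vs x)
      where
      bit-∨ : ∀ a b → bit a ≤ bit (a ∨ b)
      bit-∨ false b = z≤n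
      bit-∨ true b = s≤s z≤n

    Path : Fin n → Fin n → Fin n → Set
    Path x y z = x ~ y × y ~ z

    -- That `u` is a vertex is recorded so that disjointness protects all other triangles from the
    -- deletion.
    Broken : Fin n → Fin n → Fin n → Set
    Broken x y z = (u ≡ x ⊎ u ≡ y ⊎ u ≡ z) × (Path x y z ⊎ Path y z x ⊎ Path z x y)

    -- The vertices being distinct, at most one of the three links is the new edge; the other two
    -- form a path.
    break-source : ∀ {x y z} → y ≢ z → x ≢ y → x ≢ z → G⁺.Source x y z → Source x y z ⊎ Broken x y z
    break-source y≢z x≢y x≢z (p , q , r) with old-or-new p | old-or-new q | old-or-new-link r
    ... | inj₁ p | inj₁ q | inj₁ r = inj₁ (p , q , r)
    ... | inj₁ p | inj₁ q | inj₂ (inj₁ (y≡u , _)) = inj₂ (inj₂ (inj₁ (sym y≡u)) , inj₂ (inj₂ (inj₂ q , inj₁ p)))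
    ... | inj₁ p | inj₁ q | inj₂ (inj₂ (z≡u , _)) = inj₂ (inj₂ (inj₂ (sym z≡u)) , inj₂ (inj₂ (inj₂ q , inj₁ p)))
    ... | inj₁ p | inj₂ (x≡u , _) | inj₁ r = inj₂ (inj₁ (sym x≡u) , inj₁ (inj₁ p , r))
    ... | inj₁ p | inj₂ (x≡u , z≡v) | inj₂ (inj₁ (y≡u , _)) = contradiction (trans x≡u (sym y≡u)) x≢y
    ... | inj₁ p | inj₂ (x≡u , z≡v) | inj₂ (inj₂ (z≡u , _)) = contradiction (trans x≡u (sym z≡u)) x≢z
    ... | inj₂ (x≡u , _) | inj₁ q | inj₁ r = inj₂ (inj₁ (sym x≡u) , inj₂ (inj₁ (r , inj₂ q)))
    ... | inj₂ (x≡u , _) | inj₁ q | inj₂ (inj₁ (y≡u , _)) = contradiction (trans x≡u (sym y≡u)) x≢y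
    ... | inj₂ (x≡u , _) | inj₁ q | inj₂ (inj₂ (z≡u , _)) = contradiction (trans x≡u (sym z≡u)) x≢z
    ... | inj₂ (_ , y≡v) | inj₂ (_ , z≡v) | _ = contradiction (trans y≡v (sym z≡v)) y≢z

    break : ∀ {x y z} → x ≢ y → x ≢ z → y ≢ z → G⁺.Tri x y z → Tri x y z ⊎ Broken x y z
    break x≢y x≢z y≢z (G⁺.source₁ s) = Sum.map₁ source₁ (break-source y≢z x≢y x≢z s)
    break x≢y x≢z y≢z (G⁺.source₂ s) with break-source x≢z (x≢y ∘ sym) y≢z s
    ... | inj₁ s = inj₁ (source₂ s)
    ... | inj₂ (u∈ , p) = inj₂
      ( [ inj₂ ∘ inj₁ , [ inj₁ , inj₂ ∘ inj₂ ]′ ]′ u∈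
      , [ (λ (a , b) → inj₂ (inj₂ (~-sym b , ~-sym a)))
        , [ (λ (a , b) → inj₂ (inj₁ (~-sym b , ~-sym a)))
          , (λ (a , b) → inj₁ (~-sym b , ~-sym a)) ]′ ]′ p )
    break x≢y x≢z y≢z (G⁺.source₃ s) with break-source x≢y (x≢z ∘ sym) (y≢z ∘ sym) s
    ... | inj₁ s = inj₁ (source₃ s)
    ... | inj₂ (u∈ , p) = inj₂
      ( [ inj₂ ∘ inj₂ , [ inj₁ , inj₂ ∘ inj₁ ]′ ]′ u∈
      , [ inj₂ ∘ inj₂ , [ inj₁ , inj₂ ∘ inj₁ ]′ ]′ p )

    untouched : ∀ {ts} → All G⁺.IsTri ts → Unique (flatten ts) → All (u ≢_) (flatten ts) → All IsTri ts
    untouched [] _ _ = []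
    untouched (tri ∷ ps) ((x≢y ∷ x≢z ∷ _) ∷ (y≢z ∷ _) ∷ _ ∷ distinct) (u≢x ∷ u≢y ∷ u≢z ∷ avoid)
      with break x≢y x≢z y≢z tri
    ... | inj₁ tri = tri ∷ untouched ps distinct avoid
    ... | inj₂ (u∈ , _) = contradiction u∈ [ u≢x , [ u≢y , u≢z ]′ ]′

    BrokenPacking : List (Fin n) → Set
    BrokenPacking ws = ∃ λ W → ∃ λ ts → All IsTri ts × vertices W ++ flatten ts ↭ ws ×
      W 0F ~ W 1F × W 1F ~ W 2F

    -- The broken triangle is rotated so that the lost link joins its first and last vertex. The
    -- others avoid `u`, hence survive.
    remove-edge : ∀ {ts} → All G⁺.IsTri ts → Unique (flatten ts) → All IsTri ts ⊎ BrokenPacking (flatten ts)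
    remove-edge [] _ = inj₁ []
    remove-edge {T ∷ ts} (tri ∷ ps) ((x≢y ∷ x≢z ∷ x∉) ∷ (y≢z ∷ y∉) ∷ z∉ ∷ distinct)
      with break x≢y x≢z y≢z tri
    ... | inj₂ (u∈ , path) = inj₂ (reordered path)
      where
      ps′ : All IsTri ts
      ps′ = untouched ps distinct ([ (λ { refl → x∉ }) , [ (λ { refl → y∉ }) , (λ { refl → z∉ }) ]′ ]′ u∈)

      rotated : ∀ t → T t ~ T (next t) → T (next t) ~ T (next² t) → BrokenPacking (flatten (T ∷ ts))
      rotated t a b = triple (T t) (T (next t)) (T (next² t)) , ts , ps′ ,
        ++⁺ʳ (flatten ts) (↭-sym (rotate T t)) , a , b

      reordered : Path (T 0F) (T 1F) (T 2F) ⊎ Path (T 1F) (T 2F) (T 0F) ⊎ Path (T 2F) (T 0F) (T 1F) →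
        BrokenPacking (flatten (T ∷ ts))
      reordered (inj₁ (a , b)) = rotated 0F a b
      reordered (inj₂ (inj₁ (a , b))) = rotated 1F a b
      reordered (inj₂ (inj₂ (a , b))) = rotated 2F a b
    ... | inj₁ tri with remove-edge ps distinct
    ... | inj₁ ps = inj₁ (tri ∷ ps)
    ... | inj₂ (W , ts′ , ps′ , σ , a , b) = inj₂ (W , T ∷ ts′ , tri ∷ ps′ ,
      ↭-trans (shifts (vertices W) (vertices T)) (++⁺ˡ (vertices T) σ) , a , b)

  -- Loops are skipped to stay irreflexive. The head of the list is added last, so `descend` can
  -- delete it first.
  addEdges : List (Fin n × Fin n) → Graph′ → Graph′
  addEdges [] A = A
  addEdges ((u , v) ∷ L) A = if does (u ≟ᶠ v) then addEdges L A else addEdge u v (addEdges L A)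

  addEdges-monotone : ∀ L {A x y} → A x y ≡ true → addEdges L A x y ≡ true
  addEdges-monotone [] e = e
  addEdges-monotone ((u , v) ∷ L) {A} {x} {y} e with u ≟ᶠ v
  ... | yes _ = addEdges-monotone L e
  ... | no _ rewrite addEdges-monotone L {A} {x} {y} e = refl

  addEdges-∈ : ∀ L {A x y} → x ≢ y → (x , y) ∈ L → addEdges L A x y ≡ true
  addEdges-∈ ((u , v) ∷ L) {A} {x} {y} x≢y (here refl) with x ≟ᶠ y
  ... | yes x≡y = contradiction x≡y x≢y
  ... | no _ rewrite dec-true (x ≟ᶠ x) refl | dec-true (y ≟ᶠ y) refl with addEdges L A x y
  ... | true = refl
  ... | false = refl
  addEdges-∈ ((u , v) ∷ L) {A} {x} {y} x≢y (there ∈L) with u ≟ᶠ v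
  ... | yes _ = addEdges-∈ L x≢y ∈L
  ... | no _ rewrite addEdges-∈ L {A} {x} {y} x≢y ∈L = refl

  module _ (vs : List (Fin n)) (distinct : Unique vs) (m : ℕ) (|vs| : length vs ≡ 3 * m) where

    record Admissible (A : Graph′) : Set where
      field
        irreflexive : ∀ x → A x x ≡ false
        degree≥  : ∀ x → 2 * m ≤ Graph.degree A vs x

    addEdges-admissible : ∀ L {A} → Admissible A → Admissible (addEdges L A)
    addEdges-admissible [] adm = adm
    addEdges-admissible ((u , v) ∷ L) {A} adm with u ≟ᶠ v
    ... | yes _ = addEdges-admissible L adm
    ... | no u≢v = record
      { irreflexive = irreflexive⁺ (addEdges L A) u≢v irreflexive
      ; degree≥  = λ x → ≤-trans (degree≥ x) (degree⁺ (addEdges L A) u≢v vs x)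
      }
      where open Admissible (addEdges-admissible L adm)

    -- If the deleted edge was used, its triangle becomes a path and `complete-path` repairs the
    -- packing within `A`.
    descend-edge : ∀ {A u v} → u ≢ v → Admissible A → Graph.Packing (addEdge u v A) vs → Graph.Packing A vs
    descend-edge {A} u≢v adm (ts , ps , σ) = repair (remove-edge A u≢v ps (Unique-resp-↭ (↭-sym σ) distinct))
      where
      open Admissible adm
      repair : All (Graph.IsTri A) ts ⊎ BrokenPacking A u≢v (flatten ts) → Graph.Packing A vs
      repair (inj₁ ps) = ts , ps , σ
      repair (inj₂ (W , ts′ , ps′ , τ , a , b)) =
        Completion.complete-path A irreflexive vs m |vs| degree≥ W a b ps′ (↭-trans τ σ)

    descend : ∀ L {A} → Admissible A → Graph.Packing (addEdges L A) vs → Graph.Packing A vs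
    descend [] adm packing = packing
    descend ((u , v) ∷ L) adm packing with u ≟ᶠ v
    ... | yes _ = descend L adm packing
    ... | no u≢v = descend L adm (descend-edge u≢v (addEdges-admissible L adm) packing)

  -- The list is cut into consecutive triples; `k * 3` unfolds by three at each step.
  complete-packing : ∀ {A : Graph′} → (∀ {x y} → x ≢ y → A x y ≡ true) →
    ∀ k vs → length vs ≡ k * 3 → Unique vs → Graph.Packing A vs
  complete-packing complete zero [] _ _ = Graph.∅ _
  complete-packing {A} complete (suc k) (x ∷ y ∷ z ∷ vs) |vs| ((x≢y ∷ x≢z ∷ _) ∷ (y≢z ∷ _) ∷ _ ∷ distinct) =
    add (fromSource (complete x≢y) (complete x≢z) (inj₁ (complete y≢z)))
      (complete-packing complete k vs (suc-injective (suc-injective (suc-injective |vs|))) distinct)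
    where open Graph A

tri-packing : ∀ m (A : Fin (3 * m) → Fin (3 * m) → Bool) → (∀ x → A x x ≡ false) →
  (∀ x → 2 * m ≤ Graph.degree A (allFin (3 * m)) x) → Graph.Packing A (allFin (3 * m))
tri-packing m A irreflexive degree≥ =
  descend vs (allFin⁺ (3 * m)) m |vs| pairs (record { irreflexive = irreflexive ; degree≥ = degree≥ })
    (complete-packing
      (λ {x} {y} x≢y → addEdges-∈ pairs x≢y (∈-cartesianProduct⁺ (∈-allFin x) (∈-allFin y)))
      m vs (trans |vs| (*-comm 3 m)) (allFin⁺ (3 * m)))
  where
  open EdgeRemoval
  vs = allFin (3 * m)
  pairs = cartesianProduct vs vs
  |vs| : length vs ≡ 3 * m
  |vs| = length-tabulate (λ i → i)

-- Back to the original digraph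

lookup∈flatten : ∀ {V : Set} (ts : List (Fin 3 → V)) i j → List.lookup ts i j ∈ flatten ts
lookup∈flatten (T ∷ ts) zero 0F = here refl
lookup∈flatten (T ∷ ts) zero 1F = there (here refl)
lookup∈flatten (T ∷ ts) zero 2F = there (there (here refl))
lookup∈flatten (T ∷ ts) (suc i) j = there (there (there (lookup∈flatten ts i j)))

∈flatten⇒lookup : ∀ {V : Set} (ts : List (Fin 3 → V)) {v} → v ∈ flatten ts → ∃ λ i → ∃ λ j → List.lookup ts i j ≡ v
∈flatten⇒lookup (T ∷ ts) (here refl) = zero , 0F , refl
∈flatten⇒lookup (T ∷ ts) (there (here refl)) = zero , 1F , refl
∈flatten⇒lookup (T ∷ ts) (there (there (here refl))) = zero , 2F , refl
∈flatten⇒lookup (T ∷ ts) (there (there (there v∈))) =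
  let i , j , eq = ∈flatten⇒lookup ts v∈ in suc i , j , eq

head≢tail : ∀ {V : Set} (T : Fin 3 → V) ts → Unique (flatten (T ∷ ts)) → ∀ j i′ j′ → T j ≢ List.lookup ts i′ j′
head≢tail T ts ((_ ∷ _ ∷ x∉) ∷ _) 0F i′ j′ = All.lookup x∉ (lookup∈flatten ts i′ j′)
head≢tail T ts (_ ∷ (_ ∷ y∉) ∷ _) 1F i′ j′ = All.lookup y∉ (lookup∈flatten ts i′ j′)
head≢tail T ts (_ ∷ _ ∷ z∉ ∷ _) 2F i′ j′ = All.lookup z∉ (lookup∈flatten ts i′ j′)

lookup-injective : ∀ {V : Set} (ts : List (Fin 3 → V)) → Unique (flatten ts) →
  ∀ i j i′ j′ → List.lookup ts i j ≡ List.lookup ts i′ j′ → i ≡ i′ × j ≡ j′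
lookup-injective (T ∷ ts) ((x≢y ∷ x≢z ∷ _) ∷ (y≢z ∷ _) ∷ _) zero j zero j′ eq = refl , same j j′ eq
  where
  same : ∀ j j′ → T j ≡ T j′ → j ≡ j′
  same 0F 0F eq = refl
  same 0F 1F eq = contradiction eq x≢y
  same 0F 2F eq = contradiction eq x≢z
  same 1F 0F eq = contradiction (sym eq) x≢y
  same 1F 1F eq = refl
  same 1F 2F eq = contradiction eq y≢z
  same 2F 0F eq = contradiction (sym eq) x≢z
  same 2F 1F eq = contradiction (sym eq) y≢z
  same 2F 2F eq = refl
lookup-injective (T ∷ ts) distinct zero j (suc i′) j′ eq = contradiction eq (head≢tail T ts distinct j i′ j′)
lookup-injective (T ∷ ts) distinct (suc i) j zero j′ eq = contradiction (sym eq) (head≢tail T ts distinct j′ i j)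
lookup-injective (T ∷ ts) (_ ∷ _ ∷ _ ∷ distinct) (suc i) j (suc i′) j′ eq =
  let eq₁ , eq₂ = lookup-injective ts distinct i j i′ j′ eq in cong suc eq₁ , eq₂

module Orientation (m : ℕ) (G : Digraph (3 * m))
  (large : (x : Fin (3 * m)) → 3 * outdeg G x ≥ 2 * (3 * m) ⊎ 3 * indeg G x ≥ 2 * (3 * m)) where

  V = Fin (3 * m)

  -- The disjunct supplied by `large x` fixes the side, also when both degrees are large.
  A : V → V → Bool
  A x y = [ (λ _ → does (edge? G x y)) , (λ _ → does (edge? G y x)) ]′ (large x)

  open Graph A

  sum-bits : ∀ {P : V → Set} (P? : ∀ v → Dec (P v)) vs → sum (map (bit ∘ does ∘ P?) vs) ≡ length (filter P? vs)
  sum-bits P? [] = refl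
  sum-bits P? (v ∷ vs) with does (P? v)
  ... | true = cong suc (sum-bits P? vs)
  ... | false = sum-bits P? vs

  two-thirds : ∀ d → 3 * d ≥ 2 * (3 * m) → 2 * m ≤ d
  two-thirds d h = *-cancelˡ-≤ 3 (≤-trans (≤-reflexive
    (trans (sym (*-assoc 3 2 m)) (*-assoc 2 3 m))) h)

  degree≥ : ∀ x → 2 * m ≤ degree (allFin (3 * m)) x
  degree≥ x with large x
  ... | inj₁ h = ≤-trans (two-thirds (outdeg G x) h) (≤-reflexive (sym (sum-bits (λ y → edge? G x y) (allFin (3 * m)))))
  ... | inj₂ h = ≤-trans (two-thirds (indeg G x) h) (≤-reflexive (sym (sum-bits (λ y → edge? G y x) (allFin (3 * m)))))

  no-loop : ∀ x → A x x ≡ false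
  no-loop x with large x
  ... | inj₁ _ = dec-false (edge? G x x) (loopless G x)
  ... | inj₂ _ = dec-false (edge? G x x) (loopless G x)

  does⇒ : ∀ {P : Set} (P? : Dec P) → does P? ≡ true → P
  does⇒ (yes p) _ = p

  Oriented : V → V → V → Set
  Oriented x y z = ∃ λ T → IsT3 G (T 0F) (T 1F) (T 2F) × vertices T ↭ x ∷ y ∷ z ∷ []

  link⇒edge : ∀ {x y} → x ~ y → Edge G x y ⊎ Edge G y x
  link⇒edge (inj₁ e) = arrow e
    where
    arrow : ∀ {x y} → x ⟶ y → Edge G x y ⊎ Edge G y x
    arrow {x} {y} e with large x
    ... | inj₁ _ = inj₁ (does⇒ (edge? G x y) e)
    ... | inj₂ _ = inj₂ (does⇒ (edge? G y x) e)
  link⇒edge (inj₂ e) = Sum.swap (link⇒edge (inj₁ e))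

  -- Both edges at `x` lie on the same side in `G`, so `x` comes first or last, and the edge between
  -- `y` and `z` orders these two.
  orient-source : ∀ {x y z} → Source x y z → Oriented x y z
  orient-source {x} {y} {z} (p , q , r) with large x | link⇒edge r
  ... | inj₁ _ | inj₁ yz = triple x y z , (does⇒ (edge? G x y) p , does⇒ (edge? G x z) q , yz) , ↭-refl
  ... | inj₁ _ | inj₂ zy = triple x z y , (does⇒ (edge? G x z) q , does⇒ (edge? G x y) p , zy) , prep _ (swap _ _ ↭-refl)
  ... | inj₂ _ | inj₁ yz = triple y z x , (yz , does⇒ (edge? G y x) p , does⇒ (edge? G z x) q) ,
    ↭-trans (prep _ (swap _ _ ↭-refl)) (swap _ _ ↭-refl)
  ... | inj₂ _ | inj₂ zy = triple z y x , (zy , does⇒ (edge? G z x) q , does⇒ (edge? G y x) p) ,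
    ↭-trans (swap _ _ ↭-refl) (↭-trans (prep _ (swap _ _ ↭-refl)) (swap _ _ ↭-refl))

  orient : ∀ {x y z} → Tri x y z → Oriented x y z
  orient (source₁ s) = orient-source s
  orient (source₂ s) = let T , t3 , σ = orient-source s in T , t3 , ↭-trans σ (swap _ _ ↭-refl)
  orient (source₃ s) = let T , t3 , σ = orient-source s in
    T , t3 , ↭-trans σ (↭-trans (swap _ _ ↭-refl) (prep _ (swap _ _ ↭-refl)))

  orient-all : ∀ {ts} → All IsTri ts → ∃ λ us → All (λ T → IsT3 G (T 0F) (T 1F) (T 2F)) us × flatten us ↭ flatten ts
  orient-all [] = [] , [] , ↭-refl
  orient-all (tri ∷ ps) =
    let T , t3 , σ = orient tri ; us , qs , τ = orient-all ps in T ∷ us , t3 ∷ qs , ++⁺ σ τ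

  index : (ts : List Triple) → All (λ T → IsT3 G (T 0F) (T 1F) (T 2F)) ts → flatten ts ↭ allFin (3 * m) →
    PerfectT3Packing m G
  index ts ps σ = (λ i → List.lookup ts (cast m≡ i)) , (λ i → All.lookup ps (∈-lookup (cast m≡ i))) , injective , covering
    where
    m≡ : m ≡ length ts
    -- Both sides, times 3, count the vertices.
    m≡ = *-cancelˡ-≡ m (length ts) 3
      (trans (sym (length-tabulate (λ i → i))) (trans (sym (↭-length σ)) (length-flatten ts)))

    injective : ∀ i j i′ j′ → List.lookup ts (cast m≡ i) j ≡ List.lookup ts (cast m≡ i′) j′ → i ≡ i′ × j ≡ j′
    injective i j i′ j′ eq =
      let eq₁ , eq₂ = lookup-injective ts (Unique-resp-↭ (↭-sym σ) (allFin⁺ (3 * m))) _ j _ j′ eq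
      in trans (sym (cast-involutive (sym m≡) m≡ i))
           (trans (cong (cast (sym m≡)) eq₁) (cast-involutive (sym m≡) m≡ i′)) , eq₂

    covering : ∀ v → ∃ λ i → ∃ λ j → List.lookup ts (cast m≡ i) j ≡ v
    covering v =
      let i , j , eq = ∈flatten⇒lookup ts (∈-resp-↭ (↭-sym σ) (∈-allFin v))
      in cast (sym m≡) i , j , trans (cong (λ k → List.lookup ts k j) (cast-involutive m≡ (sym m≡) i)) eq

theorem4p1 : (m : ℕ) (G : Digraph (3 * m)) →
    ((x : Fin (3 * m)) → 3 * outdeg G x ≥ 2 * (3 * m) ⊎ 3 * indeg G x ≥ 2 * (3 * m)) →
    PerfectT3Packing m G
theorem4p1 m G large =
  let ts , ps , σ = tri-packing m A no-loop degree≥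
      us , qs , τ = orient-all ps
  in index us qs (↭-trans τ σ)
  where open Orientation m G large
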